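{- Let $i(C,R)$ be an initial rule and $\mathrm{H}$ a set of Horn rules. Then $(\triangleright^{1} i(C,R)\ \triangleright^{0}\mathrm{H})\preceq i(C,R)\oplus\mathbf{G}(\mathrm{H})$; that is, every g-sequent obtained by an application of $i(C,R)$ followed by zero or more applications of rules from $\mathrm H$ is a conclusion of the initial rule $i(C,R)\oplus\mathbf G(\mathrm H)$.
   Context: Fix a countably infinite set $\mathtt{S}$ of sequents (atomic labels), a set $\mathcal{U}$ of vertices, and a non-empty finite set $\mathtt{E}$ of edge types. A g-sequent is $\mathcal{G}=(\mathcal{V},\mathcal{E},\mathcal{L})$ with $\mathcal{V}\subseteq\mathcal{U}$, $\mathcal{E}=\{\mathcal{E}_a\mid a\in\mathtt{E}\}$, $\mathcal{E}_a\subseteq\mathcal{V}\times\mathcal{V}$, $\mathcal{L}:\mathcal{V}\to\mathtt{S}$; written $\Gamma\vdash\Delta$ with $\Gamma$ the set of edge atoms $w\mathcal{E}_a u$ ($(w,u)\in\mathcal{E}_a$) and $\Delta$ the set of prefixed sequents $w:S$ ($\mathcal{L}(w)=S$); $\mathtt{PS}=\mathcal{U}\times\mathtt{S}$; commas denote disjoint union. Let $\overline{\mathtt E}=\{\bar a\mid a\in\mathtt E\}$, $\bar{\bar z}=z$, $\overline{x_1\cdots x_n}=\bar x_n\cdots\bar x_1$, $\varepsilon$ the empty string. Paths: $\mathcal{G}\models u\xrightarrow{a}w$ iff $(u,w)\in\mathcal{E}_a$; $\mathcal{G}\models u\xrightarrow{\bar a}w$ iff $(w,u)\in\mathcal{E}_a$;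 $u\xrightarrow{\varepsilon}w$ iff $u=w$; $u\xrightarrow{xs}w$ iff some $v$ has $u\xrightarrow{x}v$ and $v\xrightarrow{s}w$; $u\xrightarrow{\mathscr L}w$ iff $u\xrightarrow{s}w$ for some $s\in\mathscr L$. An $\mathtt{E}$-system is a finite set $\mathbf{G}$ of production rules $x\longrightarrow t$ with $x\in\mathtt{E}\cup\overline{\mathtt{E}}$, $t$ a string over $\mathtt E\cup\overline{\mathtt E}$, closed under $x\longrightarrow t\mapsto\bar x\longrightarrow\bar t$; $\mathbf{G}(s)=\{t\mid s\longrightarrow^*_{\mathbf{G}}t\}$ where $\longrightarrow^*_{\mathbf G}$ is the reflexive-transitive closure of one-step rewriting of a single occurrence of a left side. A constraint is a finite tree $C=(V,E,L)$ with $V\subseteq\mathcal U$, each edge $(w,u)\in E$ labelled $L(w,u)=\mathbf G'(a)$ for some $a\in\mathtt E$ and $\mathtt E$-system $\mathbf G'$. A g-sequent $\mathcal G$ with $V\subseteq\mathcal U(\mathcal G)$ satisfies $C$ iff $\mathcal G\models w\xrightarrow{\mathbf G'(a)}u$ for every edge with $L(w,u)=\mathbf G'(a)$. A sequent constraint is $R\subseteq\mathtt S^n\times2^{\mathtt{PS}}$; $S_1,\dots,S_n,\Delta$ satisfy $R$ iff $(S_{\pi(1)},\dots,S_{\pi(n)},\Delta)\in R$ for some permutation $\pi$. An initial rule $i(C,R)$ has no premises and conclusion any $\Gamma\vdash\Delta=(\mathcal V,\mathcal E,\mathcal L)$ that satisfies $C=(V,E,L)$, $V=\{w_1,\dots,w_n\}$,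 such that $\mathcal L(w_1),\dots,\mathcal L(w_n)$ and $\Delta\setminus\{w_i:\mathcal L(w_i)\mid i\in[n]\}$ satisfy $R$. For $s=x_1\cdots x_n$, $w\mathcal{E}_s u$ abbreviates edge atoms $w\mathcal{E}_{x_1}v_1,\dots,v_{n-1}\mathcal{E}_{x_n}u$, with $v\mathcal E_{\bar a}z$ meaning $z\mathcal E_a v$ and $w\mathcal E_\varepsilon u$ meaning $w=u$. A forward Horn rule $h_f$ (for $a\in\mathtt E$, string $s$) has premise $\Gamma,w\mathcal{E}_s u,w\mathcal{E}_a u\vdash\Delta$ and conclusion $\Gamma,w\mathcal{E}_s u\vdash\Delta$; a backward Horn rule $h_b$ is the same with $w\mathcal{E}_a u$ replaced by $u\mathcal{E}_a w$. $\mathbf{G}(h_f)=\{a\longrightarrow s,\bar a\longrightarrow\bar s\}$, $\mathbf{G}(h_b)=\{\bar a\longrightarrow s,a\longrightarrow\bar s\}$, and $\mathbf G(\mathrm H)$ is the union over $\mathrm H$. Absorb: $C\oplus\mathbf G$ replaces every label $\mathbf G'(a)$ by $(\mathbf G'\cup\mathbf G)(a)$, and $i(C,R)\oplus\mathbf G=i(C\oplus\mathbf G,R)$. Simulation: for rule sets, $\mathrm R_1\preceq\mathrm R_2$ iff whenever $\mathcal G$ is derivable from $\mathcal G_1,\dots,\mathcal G_n$ using rules of $\mathrm R_1$, it is derivable from $\mathcal G_1,\dots,\mathcal G_n$ using rules of $\mathrm R_2$. An ordered rule set $\triangleright^{i_1}\mathrm R_1\cdots\triangleright^{i_k}\mathrm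 R_k$ ($i_j\in\{0,1\}$) is the rule set $\mathrm R_1\cup\dots\cup\mathrm R_k$ restricted to derivations that (read from top to bottom) first apply at least $i_1$ rules of $\mathrm R_1$, then at least $i_2$ rules of $\mathrm R_2$, etc.; a singleton $\{\rho\}$ is written $\rho$. -}

module Defs where

open import Level using (0ℓ) renaming (suc to lsuc)
open import Data.Bool using (if_then_else_)
open import Data.Fin as Fin using (Fin; zero; suc; toℕ; inject₁; fromℕ)
open import Data.Fin.Permutation using (Permutation′; _⟨$⟩ʳ_)
open import Data.List using (List; []; _∷_; _++_; map; foldr; reverse; length; lookup)
open import Data.List.Membership.Propositional using () renaming (_∈_ to _∈ˡ_)
open import Data.List.Membership.Propositional.Properties using (∈-++⁺ˡ; ∈-++⁺ʳ; ∈-++⁻)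
open import Data.List.Properties using (map-∘; map-cong; map-id; reverse-map; reverse-involutive)
open import Data.List.Relation.Unary.Any using (Any; here; there)
open import Data.Nat as ℕ using (ℕ; suc; _+_; _≤_; NonZero)
open import Data.Product using (Σ; ∃; _×_; _,_; proj₁; proj₂)
open import Data.Sum using (_⊎_; inj₁; inj₂)
open import Data.Unit using (⊤)
open import Data.Vec using (Vec; tabulate)
import Data.Vec as Vec
import Data.Vec.Functional as Functional
open import Function using (_∘_)
open import Function.Bundles using (_↔_; _↣_; Injection)
open import Relation.Binary using (Rel)
open import Relation.Binary.Construct.Closure.Equivalence using (EqClosure)
open import Relation.Binary.Construct.Closure.ReflexiveTransitive using (Star)
open import Relation.Binary.Construct.Closure.Symmetric using (SymClosure)
open import Relation.Binary.PropositionalEquality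
  using (_≡_; refl; sym; trans; cong; cong₂)
open import Relation.Nullary using (¬_; does)
open import Relation.Unary using (Pred; _∈_; ∅; _∪_; _∖_; _⊥_; _≐_; ｛_｝)

-- Subsets are predicates; equality of subsets is mutual inclusion `_≐_`.
ℙ : Set → Set₁
ℙ A = Pred A 0ℓ

record Parameters : Set₁ where
  field
    Sequent          : Set
    Vertex           : Set
    EdgeType         : Set
    sequentCountable : Sequent ↔ ℕ
    edgeTypeFinite   : ∃ λ k → EdgeType ↔ Fin (suc k)

------------------------------------------------------------------------
-- Trees

-- Two-sided adjacency is `SymClosure`: a tree is a directed graph whose
-- underlying undirected graph is connected and has no cycle.  Asymmetry
-- excludes the cycles of length one and two.
record IsTree {n : ℕ} (Edge : Rel (Fin n) 0ℓ) : Set where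
  field
    nonEmpty   : NonZero n
    connected  : ∀ i j → EqClosure Edge i j
    asymmetric : ∀ {i j} → Edge i j → ¬ Edge j i
    acyclic    : ∀ {k} (c : Fin (3 + k) ↣ Fin n) →
                 (∀ i → SymClosure Edge (Injection.to c (inject₁ i)) (Injection.to c (suc i))) →
                 ¬ SymClosure Edge (Injection.to c (fromℕ (2 + k))) (Injection.to c zero)

module Calculus (𝒫 : Parameters) where

  open Parameters 𝒫 public

  PrefixedSequent : Set
  PrefixedSequent = Vertex × Sequent

  -- (w , a , u) is the edge atom w 𝓔ₐ u.
  EdgeAtom : Set
  EdgeAtom = Vertex × EdgeType × Vertex

  ----------------------------------------------------------------------
  -- g-sequents

  -- The irrelevant argument of `label` makes it a function of the vertex
  -- alone, and not of the evidence that the vertex belongs to 𝒱.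
  record GSequent : Set₁ where
    field
      𝒱     : ℙ Vertex
      ℰ     : EdgeType → Rel Vertex 0ℓ
      ℰ⊆𝒱×𝒱 : ∀ {a w u} → ℰ a w u → w ∈ 𝒱 × u ∈ 𝒱
      label : ∀ w → .(w ∈ 𝒱) → Sequent

  open GSequent public

  edgeAtoms : GSequent → ℙ EdgeAtom
  edgeAtoms 𝒢 (w , a , u) = ℰ 𝒢 a w u

  prefixedSequents : GSequent → ℙ PrefixedSequent
  prefixedSequents 𝒢 (w , S) = Σ (w ∈ 𝒱 𝒢) λ w∈𝒱 → label 𝒢 w w∈𝒱 ≡ S

  infix 4 _is_⊢_ _≋_

  _is_⊢_ : GSequent → ℙ EdgeAtom → ℙ PrefixedSequent → Set
  𝒢 is Γ ⊢ Δ = (edgeAtoms 𝒢 ≐ Γ) × (prefixedSequents 𝒢 ≐ Δ)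

  -- Equality of g-sequents as triples; the prefixed sequents determine
  -- both the vertex set and the labelling.
  _≋_ : GSequent → GSequent → Set
  𝒢 ≋ ℋ = 𝒢 is edgeAtoms ℋ ⊢ prefixedSequents ℋ

  ----------------------------------------------------------------------
  -- Strings and paths

  data Letter : Set where
    fwd : EdgeType → Letter
    bar : EdgeType → Letter

  Str : Set
  Str = List Letter

  conv : Letter → Letter
  conv (fwd a) = bar a
  conv (bar a) = fwd a

  conv* : Str → Str
  conv* s = reverse (map conv s)

  conv-involutive : ∀ x → conv (conv x) ≡ x
  conv-involutive (fwd a) = refl
  conv-involutive (bar a) = refl

  conv*-involutive : ∀ s → conv* (conv* s) ≡ s
  conv*-involutive s =
    trans (cong reverse (reverse-map conv (map conv s)))
      (trans (reverse-involutive (map conv (map conv s)))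
        (trans (sym (map-∘ s)) (trans (map-cong conv-involutive s) (map-id s))))

  atom : Vertex → Letter → Vertex → EdgeAtom
  atom w (fwd a) u = w , a , u
  atom w (bar a) u = u , a , w

  infix 4 _⊨_⟨_⟩→_ _⊨_⟪_⟫→_

  _⊨_⟨_⟩→_ : GSequent → Vertex → Str → Vertex → Set
  𝒢 ⊨ u ⟨ [] ⟩→ w    = u ≡ w
  𝒢 ⊨ u ⟨ x ∷ s ⟩→ w = ∃ λ v → atom u x v ∈ edgeAtoms 𝒢 × 𝒢 ⊨ v ⟨ s ⟩→ w

  _⊨_⟪_⟫→_ : GSequent → Vertex → ℙ Str → Vertex → Set
  𝒢 ⊨ u ⟪ 𝓛 ⟫→ w = ∃ λ s → s ∈ 𝓛 × 𝒢 ⊨ u ⟨ s ⟩→ w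

  ----------------------------------------------------------------------
  -- E-systems

  -- (x , t) is the production rule x ⟶ t.
  Production : Set
  Production = Letter × Str

  convᴾ : Production → Production
  convᴾ (x , t) = conv x , conv* t

  record ESystem : Set where
    field
      productions : List Production
      closed      : ∀ {p} → p ∈ˡ productions → convᴾ p ∈ˡ productions

  open ESystem public

  data _⊢_⟶_ (𝐆 : ESystem) : Str → Str → Set where
    rewriteAt : ∀ s₁ s₂ {x t} → (x , t) ∈ˡ productions 𝐆 →
                𝐆 ⊢ (s₁ ++ x ∷ s₂) ⟶ (s₁ ++ t ++ s₂)

  language : ESystem → Str → ℙ Str
  language 𝐆 s t = Star (𝐆 ⊢_⟶_) s t

  ∅ᴳ : ESystem
  ∅ᴳ = record { productions = [] ; closed = λ () }

  infixr 6 _∪ᴳ_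

  _∪ᴳ_ : ESystem → ESystem → ESystem
  𝐆 ∪ᴳ 𝐆′ = record
    { productions = productions 𝐆 ++ productions 𝐆′
    ; closed      = closed-++ ∘ ∈-++⁻ (productions 𝐆)
    }
    where
    closed-++ : ∀ {p} → p ∈ˡ productions 𝐆 ⊎ p ∈ˡ productions 𝐆′ →
                convᴾ p ∈ˡ productions 𝐆 ++ productions 𝐆′
    closed-++ (inj₁ p∈) = ∈-++⁺ˡ (closed 𝐆 p∈)
    closed-++ (inj₂ p∈) = ∈-++⁺ʳ (productions 𝐆) (closed 𝐆′ p∈)

  -- { x ⟶ s , x̄ ⟶ s̄ }
  pair : Letter → Str → ESystem
  pair x s = record
    { productions = (x , s) ∷ (conv x , conv* s) ∷ []
    ; closed      = λ where
        (here refl)         → there (here refl)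
        (there (here refl)) → here (cong₂ _,_ (conv-involutive x) (conv*-involutive s))
    }

  ----------------------------------------------------------------------
  -- Rules and derivations

  record Rule : Set₂ where
    field
      arity    : ℕ
      Instance : (Fin arity → GSequent) → GSequent → Set₁

  open Rule public

  RuleSet : Set₃
  RuleSet = Pred Rule (lsuc (lsuc 0ℓ))

  data Derivation (ℛ : RuleSet) (𝒢s : List GSequent) : GSequent → Set₂ where
    hyp : ∀ {𝒢} → Any (𝒢 ≋_) 𝒢s → Derivation ℛ 𝒢s 𝒢
    app : ∀ {ρ 𝒢} {premises : Fin (arity ρ) → GSequent} →
          ρ ∈ ℛ → Instance ρ premises 𝒢 →
          (∀ i → Derivation ℛ 𝒢s (premises i)) →
          Derivation ℛ 𝒢s 𝒢

  -- `D 𝒢s 𝒢` is read "𝒢 is derivable from 𝒢s".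
  Derivability : Set₃
  Derivability = List GSequent → GSequent → Set₂

  infix 3 _⪯_

  _⪯_ : Derivability → Derivability → Set₂
  D₁ ⪯ D₂ = ∀ 𝒢s 𝒢 → D₁ 𝒢s 𝒢 → D₂ 𝒢s 𝒢

  unordered : RuleSet → Derivability
  unordered ℛ = Derivation ℛ

  -- A list (i₁ , ℛ₁) ∷ … ∷ (iₖ , ℛₖ) ∷ [] stands for ▷^{i₁} ℛ₁ ⋯ ▷^{iₖ} ℛₖ.
  OrderedRuleSet : Set₃
  OrderedRuleSet = List (Fin 2 × RuleSet)

  module _ (σ : OrderedRuleSet) where

    Stage : Set
    Stage = Fin (length σ)

    atLeast : Stage → ℕ
    atLeast j = toℕ (proj₁ (lookup σ j))

    stageRules : Stage → RuleSet
    stageRules j = proj₂ (lookup σ j)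

    -- Membership in the union names a stage, so each rule application in a
    -- derivation is assigned to a stage even if the rule sets overlap.
    ⋃stages : RuleSet
    ⋃stages ρ = ∃ λ j → ρ ∈ stageRules j

    -- Stages never decrease from the leaves down to the conclusion, and the
    -- last one is below the bound.
    OrderedBelow : ∀ {𝒢s 𝒢} → ℕ → Derivation ⋃stages 𝒢s 𝒢 → Set
    OrderedBelow m (hyp _)            = ⊤
    OrderedBelow m (app (j , _) _ ds) =
      toℕ j ℕ.< m × (∀ i → OrderedBelow (suc (toℕ j)) (ds i))

    applications : ∀ {𝒢s 𝒢} → Stage → Derivation ⋃stages 𝒢s 𝒢 → ℕ
    applications j (hyp _)             = 0
    applications j (app (j′ , _) _ ds) =
      (if does (j Fin.≟ j′) then 1 else 0) +
      Functional.foldr _+_ 0 (λ i → applications j (ds i))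

    ordered : Derivability
    ordered 𝒢s 𝒢 = Σ (Derivation ⋃stages 𝒢s 𝒢) λ d →
      OrderedBelow (length σ) d × (∀ j → atLeast j ≤ applications j d)

  ----------------------------------------------------------------------
  -- Initial rules

  -- A label 𝐆′(a) is kept as the pair of 𝐆′ and a, since absorption is
  -- defined on the system and not on the language it generates.
  Label : Set
  Label = ESystem × EdgeType

  labelLanguage : Label → ℙ Str
  labelLanguage (𝐆 , a) = language 𝐆 (fwd a ∷ [])

  -- The vertices w₁ , … , wₙ are listed without repetition by `node`, and
  -- edges are given on their indices.
  record Constraint (n : ℕ) : Set₁ where
    field
      node      : Fin n ↣ Vertex
      Edge      : Rel (Fin n) 0ℓ
      isTree    : IsTree Edge
      edgeLabel : ∀ i j → .(Edge i j) → Label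

    vertex : Fin n → Vertex
    vertex = Injection.to node

  open Constraint public

  record Satisfies {n} (𝒢 : GSequent) (C : Constraint n) : Set where
    field
      vertices⊆𝒱 : ∀ i → vertex C i ∈ 𝒱 𝒢
      paths      : ∀ i j (e : Edge C i j) →
                   𝒢 ⊨ vertex C i ⟪ labelLanguage (edgeLabel C i j e) ⟫→ vertex C j

  open Satisfies public

  -- `respects` says that R is a relation on subsets, i.e. on predicates up
  -- to equality of subsets.
  record SequentConstraint (n : ℕ) : Set₂ where
    field
      R        : Vec Sequent n → ℙ PrefixedSequent → Set₁
      respects : ∀ {Ss Δ Δ′} → Δ ≐ Δ′ → R Ss Δ → R Ss Δ′

  open SequentConstraint public

  SatisfiesR : ∀ {n} → Vec Sequent n → ℙ PrefixedSequent → SequentConstraint n → Set₁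
  SatisfiesR {n} Ss Δ R′ =
    Σ (Permutation′ n) λ π → R R′ (tabulate λ i → Vec.lookup Ss (π ⟨$⟩ʳ i)) Δ

  record InitialRule (n : ℕ) : Set₂ where
    constructor i⟨_,_⟩
    field
      constraint        : Constraint n
      sequentConstraint : SequentConstraint n

  open InitialRule public

  module _ {n} (𝒢 : GSequent) (C : Constraint n) (V⊆𝒱 : ∀ i → vertex C i ∈ 𝒱 𝒢) where

    constrainedLabel : Fin n → Sequent
    constrainedLabel i = label 𝒢 (vertex C i) (V⊆𝒱 i)

    constrained : ℙ PrefixedSequent
    constrained p = ∃ λ i → p ≡ (vertex C i , constrainedLabel i)

  IsInitial : ∀ {n} → InitialRule n → GSequent → Set₁
  IsInitial i⟨ C , R ⟩ 𝒢 = Σ (Satisfies 𝒢 C) λ sat →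
    SatisfiesR (tabulate (constrainedLabel 𝒢 C (vertices⊆𝒱 sat)))
               (prefixedSequents 𝒢 ∖ constrained 𝒢 C (vertices⊆𝒱 sat))
               R

  initialRule : ∀ {n} → InitialRule n → Rule
  initialRule ι = record { arity = 0 ; Instance = λ _ → IsInitial ι }

  infixl 6 _⊕ᶜ_ _⊕_

  _⊕ᶜ_ : ∀ {n} → Constraint n → ESystem → Constraint n
  C ⊕ᶜ 𝐆 = record
    { node      = node C
    ; Edge      = Edge C
    ; isTree    = isTree C
    ; edgeLabel = λ i j e → absorb (edgeLabel C i j e)
    }
    where
    absorb : Label → Label
    absorb (𝐆′ , a) = 𝐆′ ∪ᴳ 𝐆 , a

  _⊕_ : ∀ {n} → InitialRule n → ESystem → InitialRule n
  i⟨ C , R ⟩ ⊕ 𝐆 = i⟨ C ⊕ᶜ 𝐆 , R ⟩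

  ----------------------------------------------------------------------
  -- Horn rules

  data HornRule : Set where
    h-f h-b : EdgeType → Str → HornRule

  -- A choice of v₁ , … , vₙ₋₁ in the abbreviation w 𝓔ₛ u.
  data Through : Vertex → Str → Vertex → Set where
    done : ∀ {w} → Through w [] w
    via  : ∀ {w x s u} v → Through v s u → Through w (x ∷ s) u

  atoms : ∀ {w s u} → Through w s u → ℙ EdgeAtom
  atoms done                    = ∅
  atoms (via {w} {x} v through) = ｛ atom w x v ｝ ∪ atoms through

  -- Premise  Γ , w 𝓔ₛ u , e ⊢ Δ  and conclusion  Γ , w 𝓔ₛ u ⊢ Δ,  for the edge
  -- atom e that the rule removes; the commas are disjoint unions.
  record HornInstance (s : Str) (e : Vertex → Vertex → EdgeAtom)
                      (premise conclusion : GSequent) : Set₁ where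
    field
      Γ                : ℙ EdgeAtom
      Δ                : ℙ PrefixedSequent
      w u              : Vertex
      through          : Through w s u
      Γ-disjoint       : Γ ⊥ atoms through
      e-disjoint       : (Γ ∪ atoms through) ⊥ ｛ e w u ｝
      premise-shape    : premise is (Γ ∪ atoms through) ∪ ｛ e w u ｝ ⊢ Δ
      conclusion-shape : conclusion is Γ ∪ atoms through ⊢ Δ

  HornStep : HornRule → GSequent → GSequent → Set₁
  HornStep (h-f a s) = HornInstance s (λ w u → w , a , u)
  HornStep (h-b a s) = HornInstance s (λ w u → u , a , w)

  hornRule : HornRule → Rule
  hornRule h = record { arity = 1 ; Instance = λ premises → HornStep h (premises zero) }

  hornRules : List HornRule → RuleSet
  hornRules H ρ = ∃ λ h → h ∈ˡ H × ρ ≡ hornRule h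

  𝐆ʰ : HornRule → ESystem
  𝐆ʰ (h-f a s) = pair (fwd a) s
  𝐆ʰ (h-b a s) = pair (bar a) s

  𝐆ᴴ : List HornRule → ESystem
  𝐆ᴴ H = foldr _∪ᴳ_ ∅ᴳ (map 𝐆ʰ H)

  -- 𝒢 follows from 𝒢₀ by zero or more applications of rules from H.
  HornSteps : List HornRule → GSequent → GSequent → Set₁
  HornSteps H = Star (λ 𝒢₀ 𝒢 → ∃ λ h → h ∈ˡ H × HornStep h 𝒢₀ 𝒢)

{-# OPTIONS --safe #-}

-- A Horn rule deletes an edge w –y→ u in the presence of a path w –s→ u, and its
-- production y ⟶ s (with converse) rewrites any traversal of the deleted edge
-- into a traversal of that path.  Hence a path of the premise spelling a word of
-- 𝐆′(a) becomes a path of the conclusion spelling a word derivable from it once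
-- 𝐆(H) is absorbed, while vertices and labels are unchanged.

module Submission where

open import Defs
open import Data.Fin using (zero; suc)
open import Data.Fin.Permutation using (_⟨$⟩ʳ_)
open import Data.List using (List; []; _∷_; _++_; map)
open import Data.List.Membership.Propositional using () renaming (_∈_ to _∈ˡ_)
open import Data.List.Membership.Propositional.Properties using (∈-++⁺ˡ; ∈-++⁺ʳ)
open import Data.List.Properties using (++-assoc; ++-identityʳ; unfold-reverse)
open import Data.List.Relation.Unary.Any using (here; there)
open import Data.Nat using (ℕ; _≤_)
open import Data.Nat.Properties using (+-identityʳ)
open import Data.Product using (_×_; _,_; proj₁; proj₂)
open import Data.Sum using (_⊎_; inj₁; inj₂)
open import Data.Vec as Vec using (Vec)
open import Data.Vec.Properties using (tabulate-cong)
open import Function using (_∘_; id)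
open import Relation.Binary.Construct.Closure.ReflexiveTransitive
  using (ε; _◅_; _◅◅_; gmap; return)
open import Relation.Binary.PropositionalEquality
  using (_≡_; refl; sym; trans; cong; subst; subst₂)
open import Relation.Unary using (_∈_; _∖_; _⊆_; _≐_; ｛_｝)
open import Relation.Unary.Properties using (≐-sym; ≐-trans)

module _ (𝒫 : Parameters) where

  open Calculus 𝒫

  infix 4 _⊑_

  _⊑_ : ESystem → ESystem → Set
  𝐆 ⊑ 𝐆′ = ∀ {p} → p ∈ˡ productions 𝐆 → p ∈ˡ productions 𝐆′

  language-mono : ∀ {𝐆 𝐆′ s} → 𝐆 ⊑ 𝐆′ → language 𝐆 s ⊆ language 𝐆′ s
  language-mono 𝐆⊑𝐆′ = gmap id λ where
    (rewriteAt s₁ s₂ p∈) → rewriteAt s₁ s₂ (𝐆⊑𝐆′ p∈)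

  ++-monoʳ-language : ∀ {𝐆} p {s t} → t ∈ language 𝐆 s → p ++ t ∈ language 𝐆 (p ++ s)
  ++-monoʳ-language {𝐆} p = gmap (p ++_) λ where
    (rewriteAt s₁ s₂ {x} {t} p∈) →
      subst₂ (𝐆 ⊢_⟶_) (++-assoc p s₁ (x ∷ s₂)) (++-assoc p s₁ (t ++ s₂))
        (rewriteAt (p ++ s₁) s₂ p∈)

  ++-monoˡ-language : ∀ {𝐆} p {s t} → t ∈ language 𝐆 s → t ++ p ∈ language 𝐆 (s ++ p)
  ++-monoˡ-language {𝐆} p = gmap (_++ p) λ where
    (rewriteAt s₁ s₂ {x} {t} p∈) →
      subst₂ (𝐆 ⊢_⟶_) (sym (++-assoc s₁ (x ∷ s₂) p))
        (sym (trans (++-assoc s₁ (t ++ s₂) p) (cong (s₁ ++_) (++-assoc t s₂ p))))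
        (rewriteAt s₁ (s₂ ++ p) p∈)

  production∈language : ∀ {𝐆 x t} → (x , t) ∈ˡ productions 𝐆 → t ∈ language 𝐆 (x ∷ [])
  production∈language {𝐆} {x} {t} p∈ =
    return (subst (𝐆 ⊢ (x ∷ []) ⟶_) (++-identityʳ t) (rewriteAt [] [] p∈))

  ⟨++⟩ : ∀ {𝒢 u v w} s {t} → 𝒢 ⊨ u ⟨ s ⟩→ v → 𝒢 ⊨ v ⟨ t ⟩→ w → 𝒢 ⊨ u ⟨ s ++ t ⟩→ w
  ⟨++⟩ []      refl               q = q
  ⟨++⟩ (x ∷ s) (v , atom∈ , path) q = v , atom∈ , ⟨++⟩ s path q

  atom-conv : ∀ u x v → atom u x v ≡ atom v (conv x) u
  atom-conv u (fwd a) v = refl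
  atom-conv u (bar a) v = refl

  -- Walking a path backwards meets its edges in reverse order, each with the converse letter. It
  -- serves the second production of `pair`, for a deleted edge traversed against its direction.
  ⟨conv*⟩ : ∀ {𝒢 u v} s → 𝒢 ⊨ u ⟨ s ⟩→ v → 𝒢 ⊨ v ⟨ conv* s ⟩→ u
  ⟨conv*⟩             []      refl               = refl
  ⟨conv*⟩ {𝒢} {u} {w} (x ∷ s) (v , atom∈ , path) =
    subst (λ t → 𝒢 ⊨ w ⟨ t ⟩→ u) (sym (unfold-reverse (conv x) (map conv s)))
      (⟨++⟩ (conv* s) (⟨conv*⟩ s path)
        (u , subst (_∈ edgeAtoms 𝒢) (atom-conv u x v) atom∈ , refl))

  through⇒path : ∀ {𝒢 w s u} (th : Through w s u) → atoms th ⊆ edgeAtoms 𝒢 → 𝒢 ⊨ w ⟨ s ⟩→ u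
  through⇒path done       _  = refl
  through⇒path (via v th) ⊆𝒢 = v , ⊆𝒢 (inj₁ refl) , through⇒path th (⊆𝒢 ∘ inj₂)

  -- An edge can be traversed in just two ways, along its direction or against it. These are the two
  -- cases that the productions of `pair` have to answer.
  atom-injective : ∀ {v x v′ w y u} → atom w y u ≡ atom v x v′ →
                   (v ≡ w × x ≡ y × v′ ≡ u) ⊎ (v ≡ u × x ≡ conv y × v′ ≡ w)
  atom-injective {x = fwd _} {y = fwd _} refl = inj₁ (refl , refl , refl)
  atom-injective {x = fwd _} {y = bar _} refl = inj₂ (refl , refl , refl)
  atom-injective {x = bar _} {y = fwd _} refl = inj₂ (refl , refl , refl)
  atom-injective {x = bar _} {y = bar _} refl = inj₁ (refl , refl , refl)

  -- What one Horn step guarantees. Single letters suffice because paths are chains of edges; `x`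
  -- ranges over barred letters too, so backward traversal is included.
  record _⇝[_]_ (𝒢₀ : GSequent) (𝐆 : ESystem) (𝒢 : GSequent) : Set where
    field
      sameLabelling : prefixedSequents 𝒢₀ ≐ prefixedSequents 𝒢
      simulateEdge  : ∀ v x v′ → atom v x v′ ∈ edgeAtoms 𝒢₀ →
                      𝒢 ⊨ v ⟪ language 𝐆 (x ∷ []) ⟫→ v′

  open _⇝[_]_

  simulatePath : ∀ {𝒢₀ 𝐆 𝒢} → 𝒢₀ ⇝[ 𝐆 ] 𝒢 → ∀ {v v′} s →
                 𝒢₀ ⊨ v ⟨ s ⟩→ v′ → 𝒢 ⊨ v ⟪ language 𝐆 s ⟫→ v′
  simulatePath sim         []      refl               = [] , ε , refl
  simulatePath sim {v = u} (x ∷ s) (v , atom∈ , path)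
    with simulateEdge sim u x v atom∈ | simulatePath sim s path
  ... | t , x⟶*t , p | t′ , s⟶*t′ , q =
    -- Rewriting acts inside any context: first the tail `s` becomes `t′` behind `x`, then `x`
    -- becomes `t` in front of `t′`.
    t ++ t′ , ++-monoʳ-language (x ∷ []) s⟶*t′ ◅◅ ++-monoˡ-language t′ x⟶*t , ⟨++⟩ t p q

  -- Taking a letter `y` treats both kinds of Horn rule at once: `atom w (bar a) u` unfolds to the
  -- edge atom that a backward rule removes.
  hornInstance-⇝ : ∀ {𝐆 y s 𝒢₀ 𝒢} → pair y s ⊑ 𝐆 →
                   HornInstance s (λ w u → atom w y u) 𝒢₀ 𝒢 → 𝒢₀ ⇝[ 𝐆 ] 𝒢
  hornInstance-⇝ {𝐆} {y} {s} {𝒢₀} {𝒢} pair⊑𝐆 step = record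
    { sameLabelling = ≐-trans (proj₂ premise-shape) (≐-sym (proj₂ conclusion-shape))
    ; simulateEdge  = λ v x v′ → simulate v x v′ ∘ proj₁ (proj₁ premise-shape)
    }
    where
    open HornInstance step

    kept : _ ⊆ edgeAtoms 𝒢
    kept = proj₂ (proj₁ conclusion-shape)

    path : 𝒢 ⊨ w ⟨ s ⟩→ u
    path = through⇒path through (kept ∘ inj₂)

    simulate : ∀ v x v′ → _ → 𝒢 ⊨ v ⟪ language 𝐆 (x ∷ []) ⟫→ v′
    -- A surviving edge is traversed as before, with no rewriting.
    simulate v x v′ (inj₁ atom∈) = x ∷ [] , ε , v′ , kept atom∈ , refl
    simulate v x v′ (inj₂ removed) with atom-injective {v} {x} {v′} {w} {y} {u} removed
    ... | inj₁ (refl , refl , refl) =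
      s , production∈language (pair⊑𝐆 (here refl)) , path
    ... | inj₂ (refl , refl , refl) =
      conv* s , production∈language (pair⊑𝐆 (there (here refl))) , ⟨conv*⟩ s path

  𝐆ʰ⊑𝐆ᴴ : ∀ {h H} → h ∈ˡ H → 𝐆ʰ h ⊑ 𝐆ᴴ H
  𝐆ʰ⊑𝐆ᴴ                (here refl) = ∈-++⁺ˡ
  𝐆ʰ⊑𝐆ᴴ {H = h′ ∷ _} (there h∈H) = ∈-++⁺ʳ (productions (𝐆ʰ h′)) ∘ 𝐆ʰ⊑𝐆ᴴ h∈H

  hornStep-⇝ : ∀ {h H 𝒢₀ 𝒢} → h ∈ˡ H → HornStep h 𝒢₀ 𝒢 → 𝒢₀ ⇝[ 𝐆ᴴ H ] 𝒢
  hornStep-⇝ {h-f a s} h∈H = hornInstance-⇝ {y = fwd a} (𝐆ʰ⊑𝐆ᴴ {h-f a s} h∈H)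
  hornStep-⇝ {h-b a s} h∈H = hornInstance-⇝ {y = bar a} (𝐆ʰ⊑𝐆ᴴ {h-b a s} h∈H)

  -- `label` ignores its membership proof, so the proof that `Δ₀≐Δ` produces may stand in for `v∈`.
  label-≐ : ∀ {𝒢₀ 𝒢} → prefixedSequents 𝒢₀ ≐ prefixedSequents 𝒢 →
            ∀ {v} (v∈₀ : v ∈ 𝒱 𝒢₀) (v∈ : v ∈ 𝒱 𝒢) → label 𝒢₀ v v∈₀ ≡ label 𝒢 v v∈
  label-≐ Δ₀≐Δ v∈₀ v∈ = sym (proj₂ (proj₁ Δ₀≐Δ (v∈₀ , refl)))

  -- The base of the induction on Horn steps. Absorption only enlarges languages and keeps the
  -- nodes, so `satR` carries over as it is.
  initial-⊕ : ∀ {n} (ι : InitialRule n) {𝐆 𝒢} → IsInitial ι 𝒢 → IsInitial (ι ⊕ 𝐆) 𝒢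
  initial-⊕ i⟨ C , R ⟩ (sat , satR) = record
    { vertices⊆𝒱 = vertices⊆𝒱 sat
    ; paths      = λ i j e → let t , t∈ , path = paths sat i j e in
                   t , language-mono ∈-++⁺ˡ t∈ , path
    } , satR

  -- The absorbed rule appears on both sides so that the lemma can be iterated: a word already
  -- derived with `𝐆` is merely rewritten further.
  initial-⇝ : ∀ {n} (ι : InitialRule n) {𝐆 𝒢₀ 𝒢} → 𝒢₀ ⇝[ 𝐆 ] 𝒢 →
              IsInitial (ι ⊕ 𝐆) 𝒢₀ → IsInitial (ι ⊕ 𝐆) 𝒢
  initial-⇝ i⟨ C , R′ ⟩ {𝐆} {𝒢₀} {𝒢} sim (sat₀ , π , r) =
    sat , π , subst (λ Ss → R R′ (permuted Ss) rest) (tabulate-cong labels≡)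
                (respects R′ rest≐ r)
    where
    Δ₀≐Δ = sameLabelling sim

    sat : Satisfies 𝒢 (C ⊕ᶜ 𝐆)
    sat = record
      { vertices⊆𝒱 = λ i → proj₁ (proj₁ Δ₀≐Δ (vertices⊆𝒱 sat₀ i , refl))
      ; paths      = λ i j e →
          let t , a⟶*t , path   = paths sat₀ i j e
              t′ , t⟶*t′ , path′ = simulatePath sim t path
          in t′ , a⟶*t ◅◅ language-mono (∈-++⁺ʳ _) t⟶*t′ , path′
      }

    permuted : Vec Sequent _ → Vec Sequent _
    permuted Ss = Vec.tabulate λ i → Vec.lookup Ss (π ⟨$⟩ʳ i)

    labels≡ : ∀ i → constrainedLabel 𝒢₀ (C ⊕ᶜ 𝐆) (vertices⊆𝒱 sat₀) i ≡
                    constrainedLabel 𝒢 (C ⊕ᶜ 𝐆) (vertices⊆𝒱 sat) i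
    labels≡ i = label-≐ {𝒢₀} {𝒢} Δ₀≐Δ (vertices⊆𝒱 sat₀ i) (vertices⊆𝒱 sat i)

    rest : ℙ PrefixedSequent
    rest = prefixedSequents 𝒢 ∖ constrained 𝒢 (C ⊕ᶜ 𝐆) (vertices⊆𝒱 sat)

    rest≐ : (prefixedSequents 𝒢₀ ∖ constrained 𝒢₀ (C ⊕ᶜ 𝐆) (vertices⊆𝒱 sat₀)) ≐ rest
    rest≐ =
      (λ (p∈ , p∉) → proj₁ Δ₀≐Δ p∈ , λ (i , p≡) →
        p∉ (i , trans p≡ (cong (vertex C i ,_) (sym (labels≡ i))))) ,
      (λ (p∈ , p∉) → proj₂ Δ₀≐Δ p∈ , λ (i , p≡) →
        p∉ (i , trans p≡ (cong (vertex C i ,_) (labels≡ i))))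

  hornSteps-initial : ∀ {n} (ι : InitialRule n) {H 𝒢₀ 𝒢} → HornSteps H 𝒢₀ 𝒢 →
                      IsInitial (ι ⊕ 𝐆ᴴ H) 𝒢₀ → IsInitial (ι ⊕ 𝐆ᴴ H) 𝒢
  hornSteps-initial ι ε                          init = init
  hornSteps-initial ι ((_ , h∈H , step) ◅ steps) init =
    hornSteps-initial ι steps (initial-⇝ ι (hornStep-⇝ h∈H step) init)

  module _ {n} (ι : InitialRule n) (H : List HornRule) where

    initialThenHorn : OrderedRuleSet
    initialThenHorn = (suc zero , ｛ initialRule ι ｝) ∷ (zero , hornRules H) ∷ []

    -- Horn rules are unary, so a derivation with an application of the initial
    -- rule is linear and has no hypothesis at its top.
    derivation⇒initial : ∀ {𝒢s 𝒢} (d : Derivation (⋃stages initialThenHorn) 𝒢s 𝒢) →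
                         1 ≤ applications initialThenHorn zero d →
                         IsInitial (ι ⊕ 𝐆ᴴ H) 𝒢
    derivation⇒initial (app (zero , refl) init _) _ = initial-⊕ ι init
    derivation⇒initial (app (suc zero , h , h∈H , refl) step ds) 1≤ =
      initial-⇝ ι (hornStep-⇝ h∈H step)
        -- The Horn step adds 0 to the count of the initial stage, and the fold over its single
        -- premise leaves a trailing `+ 0`.
        (derivation⇒initial (ds zero) (subst (1 ≤_) (+-identityʳ _) 1≤))

mainTheorem4 : (𝒫 : Parameters) → let open Calculus 𝒫 in
    (n : ℕ) (ι : InitialRule n) (H : List HornRule) →
    (ordered ((suc zero , ｛ initialRule ι ｝) ∷ (zero , hornRules H) ∷ [])
    ⪯ unordered ｛ initialRule (ι ⊕ 𝐆ᴴ H) ｝)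
    × (∀ 𝒢₀ 𝒢 → IsInitial ι 𝒢₀ → HornSteps H 𝒢₀ 𝒢 → IsInitial (ι ⊕ 𝐆ᴴ H) 𝒢)
mainTheorem4 𝒫 n ι H =
  (λ 𝒢s 𝒢 (d , _ , atLeast≤) →
    -- The initial stage carries the exponent 1, so `atLeast≤ zero` yields an application of `ι` in
    -- `d`.
    Calculus.app {premises = λ ()} refl (derivation⇒initial 𝒫 ι H d (atLeast≤ zero)) (λ ())) ,
  (λ 𝒢₀ 𝒢 init steps → hornSteps-initial 𝒫 ι steps (initial-⊕ 𝒫 ι init))
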